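{- There is an absolute constant $c>0$ such that for every prime $p$, every connected component of the graph $\mathcal{X}_p$ has size (number of vertices) at least $c(\log p)^{7/9}$.
   Context: For a prime $p$, let $\mathbb{F}_p$ be the field of $p$ elements and let $\mathcal{M}_p$ be the set of triples $(x,y,z)\in\mathbb{F}_p^3\setminus\{(0,0,0)\}$ satisfying $x^2+y^2+z^2=3xyz$ in $\mathbb{F}_p$. The maps $$\mathcal{R}_1:(x,y,z)\mapsto(3yz-x,y,z),\quad \mathcal{R}_2:(x,y,z)\mapsto(x,3xz-y,z),\quad \mathcal{R}_3:(x,y,z)\mapsto(x,y,3xy-z)$$ are involutions of $\mathcal{M}_p$, and the permutations in $S_3$ of the three coordinates also map $\mathcal{M}_p$ to itself. The graph $\mathcal{X}_p$ has vertex set $\mathcal{M}_p$, with an edge from $v_1$ to $v_2$ whenever $v_2=T(v_1)$ for some $T\in\{\mathcal{R}_1,\mathcal{R}_2,\mathcal{R}_3\}\cup S_3$. Its connected components are the orbits of the group generated by these transformations. -}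

module Defs where

open import Algebra.Definitions.RawSemiring using () renaming (_^_ to pow)
open import Data.Fin.Base using (Fin; toℕ)
open import Data.Fin.Permutation using (Permutation′; _⟨$⟩ʳ_)
open import Data.Integer.Base using (+_)
open import Data.List.Base using (List; length)
open import Data.List.Membership.Propositional using (_∈_)
open import Data.List.Relation.Unary.Unique.Propositional using (Unique)
open import Data.Nat.Base as ℕ using (ℕ; zero; suc; NonZero; _!)
open import Data.Nat.DivMod using (_mod_)
open import Data.Nat.Primality using (Prime; prime⇒nonZero)
open import Data.Nat.Properties using (_!≢0)
open import Data.Product.Base using (_×_; ∃-syntax)
open import Data.Rational.Base as ℚ using (ℚ; 0ℚ)
open import Data.Vec.Base using (Vec; []; _∷_; lookup; replicate; tabulate)
open import Function.Bundles using (_⇔_)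
open import Level using (0ℓ)
open import Relation.Binary.Construct.Closure.Equivalence using (EqClosure)
open import Relation.Binary.Core using (Rel)
open import Relation.Binary.PropositionalEquality using (_≡_; _≢_)
open import Relation.Unary using (Pred)

HasSize : {A : Set} → Pred A 0ℓ → ℕ → Set
HasSize P n =
  ∃[ xs ] (Unique xs × (∀ x → x ∈ xs ⇔ P x) × length xs ≡ n)

module Markoff {p : ℕ} (prime : Prime p) where

  private instance
    p≢0 : NonZero p
    p≢0 = prime⇒nonZero prime

  𝔽 : Set
  𝔽 = Fin p

  infixl 6 _+_ _-_
  infixl 7 _*_

  fromℕ : ℕ → 𝔽
  fromℕ n = n mod p

  _+_ _*_ _-_ : 𝔽 → 𝔽 → 𝔽
  x + y = fromℕ (toℕ x ℕ.+ toℕ y)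
  x * y = fromℕ (toℕ x ℕ.* toℕ y)
  x - y = fromℕ (toℕ x ℕ.+ (p ℕ.∸ toℕ y))

  𝔽³ : Set
  𝔽³ = Vec 𝔽 3

  IsSolution : 𝔽³ → Set
  IsSolution (x ∷ y ∷ z ∷ []) = x * x + y * y + z * z ≡ fromℕ 3 * x * y * z

  -- The proofs are irrelevant, so two vertices are equal as soon as their
  -- coordinates are.
  record Vertex : Set where
    constructor vertex
    field
      coords    : 𝔽³
      .nonzero  : coords ≢ replicate 3 (fromℕ 0)
      .solution : IsSolution coords
  open Vertex public

  data Transformation : Set where
    ℛ₁ ℛ₂ ℛ₃ : Transformation
    permute  : Permutation′ 3 → Transformation

  ⟦_⟧ : Transformation → 𝔽³ → 𝔽³
  ⟦ ℛ₁ ⟧ (x ∷ y ∷ z ∷ []) = fromℕ 3 * y * z - x ∷ y ∷ z ∷ []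
  ⟦ ℛ₂ ⟧ (x ∷ y ∷ z ∷ []) = x ∷ fromℕ 3 * x * z - y ∷ z ∷ []
  ⟦ ℛ₃ ⟧ (x ∷ y ∷ z ∷ []) = x ∷ y ∷ fromℕ 3 * x * y - z ∷ []
  ⟦ permute π ⟧ v = tabulate (λ i → lookup v (π ⟨$⟩ʳ i))

  Edge : Rel Vertex 0ℓ
  Edge v₁ v₂ = ∃[ T ] coords v₂ ≡ ⟦ T ⟧ (coords v₁)

  Component : Vertex → Pred Vertex 0ℓ
  Component v = EqClosure Edge v

infixr 8 _^_
_^_ : ℚ → ℕ → ℚ
_^_ = pow ℚ.+-*-rawSemiring

fromℕ : ℕ → ℚ
fromℕ n = + n ℚ./ 1

-- A non-negative real number is given by a set of non-negative rationals whose
-- supremum it is. Different sets may have the same supremum; only the relation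
-- _≤ℝ_ below, which depends on the supremum alone, is used to compare them.
ℝ≥0 : Set₁
ℝ≥0 = Pred ℚ 0ℓ

-- The sum of q ^ j / j ! over j < k.
expSum : ℚ → ℕ → ℚ
expSum q zero    = 0ℚ
expSum q (suc k) = expSum q k ℚ.+ q ^ k ℚ.* (ℚ._/_ (+ 1) (k !) {{k !≢0}})

-- The natural logarithm of an integer n ≥ 1. For q ≥ 0 the partial sums
-- increase to exp q, so the condition on them says exp q ≤ n, i.e. q ≤ log n.
log : ℕ → ℝ≥0
log n q = 0ℚ ℚ.≤ q × (∀ k → expSum q k ℚ.≤ fromℕ n)

-- The power r ^ (a / b): for q ≥ 0, the supremum of the rationals s ≥ 0 with
-- s ^ b ≤ q ^ a is q ^ (a / b).
infix 8 _^[_/_]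
_^[_/_] : ℝ≥0 → ℕ → (b : ℕ) → .{{NonZero b}} → ℝ≥0
(r ^[ a / b ]) s = 0ℚ ℚ.≤ s × (∃[ q ] (r q × s ^ b ℚ.≤ q ^ a))

-- The product of r with a rational c ≥ 0.
infixr 7 _·_
_·_ : ℚ → ℝ≥0 → ℝ≥0
(c · r) s = ∃[ q ] (r q × s ≡ c ℚ.* q)

infix 4 _≤ℝ_
_≤ℝ_ : ℝ≥0 → ℚ → Set
r ≤ℝ u = ∀ {s} → r s → s ℚ.≤ u

{-# OPTIONS --safe #-}

-- The weight 2x/(yz) of a solution satisfies w(v) + w(ℛ₁ v) = 6, by Vieta, and
-- the three weights obtained by permuting the coordinates of v add up to 6, by
-- the Markoff equation. A component with N vertices is mapped to itself by ℛ₁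
-- and by the transpositions, so its total weight S satisfies 2S = 6N and
-- 3S = 6N in 𝔽_p. Hence p divides 6N (for p > 3 this is Chen's theorem that p
-- divides N), which gives N ≥ p/6, far more than a power of log p.

module Submission where

open import Defs
open import Data.Fin.Base using (Fin; toℕ; punchIn) renaming (zero to fzero; suc to fsuc)
open import Data.Fin.Permutation as Perm
  using (Permutation′; _⟨$⟩ʳ_; insert; remove; insert-remove; transpose)
import Data.Fin.Properties as Fin
import Data.Integer.Base as ℤ
import Data.Integer.Properties as ℤ
open import Data.List.Base
  using (List; []; _∷_; length; map; filter; deduplicate; allFin; concatMap; cartesianProductWith)
open import Data.List.Membership.Propositional using (_∈_; lose)
open import Data.List.Membership.Propositional.Properties
  using (∈-map⁺; ∈-map⁻; ∈-filter⁺; ∈-filter⁻; ∈-deduplicate⁺; ∈-deduplicate⁻;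
         ∈-allFin; ∈-concatMap⁺; ∈-cartesianProductWith⁺)
open import Data.List.Membership.Propositional.Properties.WithK using (unique∧set⇒bag)
open import Data.List.Properties using (map-∘)
open import Data.List.Relation.Binary.BagAndSetEquality using (∼bag⇒↭)
open import Data.List.Relation.Binary.Permutation.Propositional using (_↭_)
open import Data.List.Relation.Binary.Permutation.Propositional.Properties
  using () renaming (map⁺ to ↭-map⁺)
open import Data.List.Relation.Unary.Any using (Any; here; there; any?; satisfied)
import Data.List.Relation.Unary.Unique.DecPropositional.Properties as DecUnique
open import Data.List.Relation.Unary.Unique.Propositional using (Unique)
open import Data.List.Relation.Unary.Unique.Propositional.Properties
  using () renaming (map⁺ to Unique-map⁺)
open import Data.Nat.Base as ℕ using (ℕ; zero; suc; _+_; _*_; _∸_; _%_; NonZero)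
import Data.Nat.Coprimality as Coprimality
open Coprimality using (Coprime; coprime-Bézout)
open import Data.Nat.Divisibility
  using (_∣_; _∤_; _∣?_; _∣0; ∣⇒≤; m%n≡0⇒n∣m; n∣m⇒m%n≡0; ∣n⇒∣m*n; ∣m⇒∣m*n; ∣m∣n⇒∣m+n)
open import Data.Nat.DivMod
  using (%-distribˡ-+; %-distribˡ-*; m%n%n≡m%n; [m+n]%n≡m%n; [m+kn]%n≡m%n; m<n⇒m%n≡m)
open import Data.Nat.GCD using (module Bézout)
open import Data.Nat.ListAction using (sum)
open import Data.Nat.ListAction.Properties using (sum-↭)
open import Data.Nat.Primality using (Prime; prime⇒irreducible; prime⇒nonZero; euclidsLemma)
open import Data.Nat.Properties
  using (+-assoc; +-comm; *-assoc; *-comm; *-suc; *-identityʳ; suc-pred; m∸n+n≡m; m≤m+n; m*n≢0)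
open import Data.Nat.Tactic.RingSolver using (solve-∀)
open import Data.Product.Base using (_×_; ∃-syntax; _,_; proj₁; proj₂)
open import Data.Rational.Base as ℚ using (ℚ; 0ℚ; 1ℚ; mkℚ; _≤_; _<_)
import Data.Rational.Properties as ℚ
open import Data.Sum.Base using (_⊎_; inj₁; inj₂; [_,_])
open import Data.Vec.Base using (Vec; []; _∷_; lookup; replicate)
import Data.Vec.Properties as Vec
open import Function.Base using (_∘_; id)
open import Function.Bundles using (mk⇔; Equivalence)
open import Level using (0ℓ)
open import Relation.Binary.Bundles using (Setoid)
import Relation.Binary.Construct.On as On
open import Relation.Binary.Construct.Closure.ReflexiveTransitive using (Star; ε; _◅_; _◅◅_; fold)
open import Relation.Binary.Construct.Closure.Symmetric using (SymClosure; fwd; bwd)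
open import Relation.Binary.Core using (Rel)
open import Relation.Binary.Definitions using (Decidable; DecidableEquality)
open import Relation.Binary.PropositionalEquality
  using (_≡_; refl; sym; trans; cong; cong₂; subst; subst₂; setoid)
import Relation.Binary.Reasoning.Setoid as SetoidReasoning
open import Relation.Nullary.Decidable
  using (Dec; yes; no; map′; _⊎-dec_; _×-dec_; ¬?; recompute)
open import Relation.Nullary.Negation using (¬_; contradiction)
open import Relation.Unary using (Pred) renaming (Decidable to Decidable₁)

-- Decidability of reachability in a finite graph, by Warshall's recursion.

module Reachability {A : Set} (_⟶_ : Rel A 0ℓ) where

  -- Paths whose interior vertices, if any, lie in the given list.
  Via : List A → Rel A 0ℓ
  Via []       x y = x ≡ y ⊎ x ⟶ y
  Via (w ∷ ws) x y = Via ws x y ⊎ (Via ws x w × Via ws w y)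

  Via-reflexive : ∀ ws {x} → Via ws x x
  Via-reflexive []       = inj₁ refl
  Via-reflexive (w ∷ ws) = inj₁ (Via-reflexive ws)

  Via-step : ∀ ws {x y} → x ⟶ y → Via ws x y
  Via-step []       s = inj₂ s
  Via-step (w ∷ ws) s = inj₁ (Via-step ws s)

  -- If `w` is the head, each path is cut at its visit to `w`, which leaves two paths through the
  -- tail. Otherwise the composite is split at the head; when both paths visit the head, the whole
  -- detour between the two visits is dropped.
  Via-trans : ∀ {ws x w y} → w ∈ ws → Via ws x w → Via ws w y → Via ws x y
  Via-trans (here refl) p q = inj₂ ([ id , proj₁ ] p , [ id , proj₂ ] q)
  Via-trans (there i) (inj₁ p)       (inj₁ q)       = inj₁ (Via-trans i p q)
  Via-trans (there i) (inj₁ p)       (inj₂ (q , r)) = inj₂ (Via-trans i p q , r)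
  Via-trans (there i) (inj₂ (p , q)) (inj₁ r)       = inj₂ (p , Via-trans i q r)
  Via-trans (there i) (inj₂ (p , _)) (inj₂ (_ , r)) = inj₂ (p , r)

  Via⇒Star : ∀ ws {x y} → Via ws x y → Star _⟶_ x y
  Via⇒Star []       (inj₁ refl)    = ε
  Via⇒Star []       (inj₂ s)       = s ◅ ε
  Via⇒Star (w ∷ ws) (inj₁ p)       = Via⇒Star ws p
  Via⇒Star (w ∷ ws) (inj₂ (p , q)) = Via⇒Star ws p ◅◅ Via⇒Star ws q

  module _ (_≟_ : DecidableEquality A) (_⟶?_ : Decidable _⟶_) where

    Via? : ∀ ws → Decidable (Via ws)
    Via? []       x y = (x ≟ y) ⊎-dec (x ⟶? y)
    Via? (w ∷ ws) x y = Via? ws x y ⊎-dec (Via? ws x w ×-dec Via? ws w y)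

    -- When `xs` lists every element, no interior vertex is excluded, so `Via xs` is full
    -- reachability, and it is decidable by recursion on `xs`.
    Star? : ∀ xs → (∀ x → x ∈ xs) → Decidable (Star _⟶_)
    Star? xs complete x y = map′ (Via⇒Star xs)
      (fold (Via xs) (λ s → Via-trans (complete _) (Via-step xs s)) (Via-reflexive xs))
      (Via? xs x y)

-- Decidable subsets of finite types and their enumeration.

SymClosure? : {A : Set} {R : Rel A 0ℓ} → Decidable R → Decidable (SymClosure R)
SymClosure? R? x y =
  map′ [ fwd , bwd ] (λ { (fwd r) → inj₁ r ; (bwd r) → inj₂ r }) (R? x y ⊎-dec R? y x)

-- The theorem asks for the size of a component as an explicit number, so membership in a component
-- must be decided. The enumeration `xs` may repeat elements, hence `deduplicate`.
hasSize : {A : Set} → DecidableEquality A → ∀ xs → (∀ (x : A) → x ∈ xs) →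
          {P : Pred A 0ℓ} → Decidable₁ P → ∃[ N ] HasSize P N
hasSize _≟_ xs complete P? =
  _ , deduplicate _≟_ (filter P? xs) , DecUnique.deduplicate-! _≟_ _ ,
  (λ x → mk⇔ (proj₂ ∘ ∈-filter⁻ P? {xs = xs} ∘ ∈-deduplicate⁻ _≟_ (filter P? xs))
             (∈-deduplicate⁺ _≟_ ∘ ∈-filter⁺ P? (complete x))) ,
  refl

permutations : ∀ n → List (Permutation′ n)
permutations zero    = Perm.id ∷ []
permutations (suc n) = cartesianProductWith (insert fzero) (allFin (suc n)) (permutations n)

insert-cong : ∀ {n} i j {π ρ : Permutation′ n} → π Perm.≈ ρ → insert i j π Perm.≈ insert i j ρ
insert-cong i j eq k with i Fin.≟ k
... | yes _ = refl
... | no  _ = cong (punchIn j) (eq _)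

-- A permutation is recovered from its value at zero and the permutation that remains after zero is
-- removed. The match is only pointwise, as function extensionality is not assumed.
permutations-complete : ∀ {n} (π : Permutation′ n) → ∃[ ρ ] (ρ ∈ permutations n × ρ Perm.≈ π)
permutations-complete {zero}  π = Perm.id , here refl , λ ()
permutations-complete {suc n} π =
  let ρ , ρ∈ , eq = permutations-complete (remove fzero π) in
  insert fzero (π ⟨$⟩ʳ fzero) ρ ,
  ∈-cartesianProductWith⁺ (insert fzero) (∈-allFin _) ρ∈ ,
  λ k → trans (insert-cong fzero _ eq k) (insert-remove fzero π k)

vectors : ∀ {A : Set} → List A → ∀ n → List (Vec A n)
vectors xs zero    = [] ∷ []
vectors xs (suc n) = cartesianProductWith _∷_ xs (vectors xs n)

vectors-complete : {A : Set} {xs : List A} → (∀ x → x ∈ xs) → ∀ {n} (v : Vec A n) → v ∈ vectors xs n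
vectors-complete complete []      = here refl
vectors-complete complete (x ∷ v) =
  ∈-cartesianProductWith⁺ _∷_ (complete x) (vectors-complete complete v)

-- An involution is injective, and each `y` in `xs` is the image of `f y`. So both lists are
-- duplicate-free with the same elements, which makes them equal as bags. It serves to reindex sums
-- over a component.
map-involution-↭ : {A : Set} {xs : List A} (f : A → A) → (∀ x → f (f x) ≡ x) →
                   Unique xs → (∀ {x} → x ∈ xs → f x ∈ xs) → map f xs ↭ xs
map-involution-↭ {xs = xs} f involutive unique closed =
  ∼bag⇒↭ (unique∧set⇒bag (Unique-map⁺ injective unique) unique
    (mk⇔ (λ y∈ → let x , x∈ , eq = ∈-map⁻ f y∈ in subst (_∈ xs) (sym eq) (closed x∈))
         (λ y∈ → subst (_∈ map f xs) (involutive _) (∈-map⁺ f (closed y∈)))))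
  where
  injective : ∀ {x y} → f x ≡ f y → x ≡ y
  injective eq = trans (sym (involutive _)) (trans (cong f eq) (involutive _))

-- Rational powers and a crude upper bound for powers of the logarithm.

fromℕ-mkℚ : ∀ n → fromℕ n ≡ mkℚ (ℤ.+ n) 0 (Coprimality.sym (Coprimality.1-coprimeTo n))
fromℕ-mkℚ n = ℚ.↥p/↧p≡p (mkℚ (ℤ.+ n) 0 _)

fromℕ-mono-≤ : ∀ {m n} → m ℕ.≤ n → fromℕ m ≤ fromℕ n
-- Division by 1 normalises through a gcd that is stuck on a variable; the explicit fractions have
-- denominator 1 definitionally.
fromℕ-mono-≤ {m} {n} m≤n rewrite fromℕ-mkℚ m | fromℕ-mkℚ n =
  ℚ.*≤* (ℤ.*-monoʳ-≤-nonNeg (ℤ.+ 1) (ℤ.+≤+ m≤n))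

fromℕ-* : ∀ m n → fromℕ (m ℕ.* n) ≡ fromℕ m ℚ.* fromℕ n
fromℕ-* m n rewrite fromℕ-mkℚ m | fromℕ-mkℚ n = cong (ℚ._/ 1) (ℤ.pos-* m n)

^-nonNeg : ∀ {q} n → 0ℚ ≤ q → 0ℚ ≤ q ^ n
^-nonNeg zero    0≤q = ℚ.nonNegative⁻¹ 1ℚ
^-nonNeg {q} (suc n) 0≤q = subst (_≤ q ^ suc n) (ℚ.*-zeroʳ q)
  (ℚ.*-monoˡ-≤-nonNeg q {{ℚ.nonNegative 0≤q}} (^-nonNeg n 0≤q))

^-monoˡ-≤ : ∀ {q r} n → 0ℚ ≤ q → q ≤ r → q ^ n ≤ r ^ n
^-monoˡ-≤ zero    0≤q q≤r = ℚ.≤-refl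
^-monoˡ-≤ {q} {r} (suc n) 0≤q q≤r = ℚ.≤-trans
  (ℚ.*-monoʳ-≤-nonNeg (q ^ n) {{ℚ.nonNegative (^-nonNeg n 0≤q)}} q≤r)
  (ℚ.*-monoˡ-≤-nonNeg r {{ℚ.nonNegative (ℚ.≤-trans 0≤q q≤r)}} (^-monoˡ-≤ n 0≤q q≤r))

1≤^ : ∀ {q} n → 1ℚ ≤ q → 1ℚ ≤ q ^ n
1≤^ {q} n 1≤q = subst (_≤ q ^ n) (1^ n) (^-monoˡ-≤ n (ℚ.nonNegative⁻¹ 1ℚ) 1≤q)
  where
  1^ : ∀ n → 1ℚ ^ n ≡ 1ℚ
  1^ zero    = refl
  1^ (suc n) = trans (ℚ.*-identityˡ _) (1^ n)

^-monoʳ-≤ : ∀ {q m n} → 1ℚ ≤ q → m ℕ.≤ n → q ^ m ≤ q ^ n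
^-monoʳ-≤ {n = n} 1≤q ℕ.z≤n = 1≤^ n 1≤q
^-monoʳ-≤ {q} 1≤q (ℕ.s≤s m≤n) =
  ℚ.*-monoˡ-≤-nonNeg q {{ℚ.nonNegative (ℚ.≤-trans (ℚ.nonNegative⁻¹ 1ℚ) 1≤q)}} (^-monoʳ-≤ 1≤q m≤n)

^-monoˡ-< : ∀ {q r} n → 0ℚ < q → q < r → q ^ suc n < r ^ suc n
^-monoˡ-< zero    0<q q<r = subst₂ _<_ (sym (ℚ.*-identityʳ _)) (sym (ℚ.*-identityʳ _)) q<r
^-monoˡ-< {q} {r} (suc n) 0<q q<r = ℚ.≤-<-trans
  (ℚ.*-monoʳ-≤-nonNeg (q ^ suc n) {{ℚ.nonNegative (^-nonNeg (suc n) (ℚ.<⇒≤ 0<q))}} (ℚ.<⇒≤ q<r))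
  (ℚ.*-monoʳ-<-pos r {{ℚ.positive (ℚ.<-trans 0<q q<r)}} (^-monoˡ-< n 0<q q<r))

-- The partial sum with two terms already gives q ≤ 1 + q ≤ n.
log-≤ : ∀ {n q} → log n q → q ≤ fromℕ n
log-≤ {n} {q} (0≤q , bounds) = ℚ.≤-trans q≤exp (bounds 2)
  where
  q≤exp : q ≤ expSum q 2
  q≤exp = subst₂ _≤_ (ℚ.+-identityˡ q)
    (cong (λ r → 1ℚ ℚ.+ r) (sym (trans (ℚ.*-identityʳ _) (ℚ.*-identityʳ q))))
    (ℚ.+-monoˡ-≤ q (ℚ.nonNegative⁻¹ 1ℚ))

-- With e = `suc b`, n < s would give n^e < s^e ≤ q^a ≤ n^a ≤ n^e. The last inequality uses both 1 ≤
-- n and a ≤ e.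
log-power-≤ : ∀ {n a b} → 1 ℕ.≤ n → a ℕ.≤ suc b → log n ^[ a / suc b ] ≤ℝ fromℕ n
log-power-≤ {n} {a} {b} 1≤n a≤b {s} (0≤s , q , log-q , s^b≤q^a) = ℚ.≮⇒≥ λ n<s →
  ℚ.<-irrefl refl (ℚ.<-≤-trans (^-monoˡ-< b 0<n n<s) (ℚ.≤-trans s^b≤q^a
    (ℚ.≤-trans (^-monoˡ-≤ a (proj₁ log-q) (log-≤ {n} log-q)) (^-monoʳ-≤ 1≤fn a≤b))))
  where
  1≤fn : 1ℚ ≤ fromℕ n
  1≤fn = fromℕ-mono-≤ 1≤n
  0<n : 0ℚ < fromℕ n
  0<n = ℚ.<-≤-trans (ℚ.positive⁻¹ 1ℚ) 1≤fn

-- Arithmetic modulo p on natural numbers.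

module Congruence (p : ℕ) .{{_ : NonZero p}} where

  infix 4 _≈_
  -- Residues are represented by natural numbers, so that the polynomial identities can be left to
  -- the ring solver for ℕ. Subtraction is avoided by adding terms to both sides and cancelling.
  _≈_ : Rel ℕ 0ℓ
  a ≈ b = a % p ≡ b % p

  ≈-setoid : Setoid 0ℓ 0ℓ
  ≈-setoid = On.setoid (setoid ℕ) (_% p)

  module ≈-Reasoning = SetoidReasoning ≈-setoid

  +-cong : ∀ {a b c d} → a ≈ b → c ≈ d → a + c ≈ b + d
  +-cong {a} {b} {c} {d} a≈b c≈d = trans (%-distribˡ-+ a c p)
    (trans (cong₂ (λ m n → (m + n) % p) a≈b c≈d) (sym (%-distribˡ-+ b d p)))

  *-cong : ∀ {a b c d} → a ≈ b → c ≈ d → a * c ≈ b * d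
  *-cong {a} {b} {c} {d} a≈b c≈d = trans (%-distribˡ-* a c p)
    (trans (cong₂ (λ m n → (m * n) % p) a≈b c≈d) (sym (%-distribˡ-* b d p)))

  +-congˡ : ∀ a {b c} → b ≈ c → a + b ≈ a + c
  +-congˡ a = +-cong {a} refl

  *-congˡ : ∀ a {b c} → b ≈ c → a * b ≈ a * c
  *-congˡ a = *-cong {a} refl

  ∣⇒≈0 : ∀ {a} → p ∣ a → a ≈ 0
  ∣⇒≈0 p∣a = trans (n∣m⇒m%n≡0 _ p p∣a) (sym (n∣m⇒m%n≡0 0 p (p ∣0)))

  ≈0⇒∣ : ∀ {a} → a ≈ 0 → p ∣ a
  ≈0⇒∣ a≈0 = m%n≡0⇒n∣m _ p (trans a≈0 (n∣m⇒m%n≡0 0 p (p ∣0)))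

  -- The multiple c(p - 1) plays the role of -c, because c + c(p - 1) = cp.
  +-cancelʳ : ∀ c {a b} → a + c ≈ b + c → a ≈ b
  +-cancelʳ c {a} {b} eq = begin
    a                      ≈⟨ absorb a ⟨
    a + c + c * (p ∸ 1)    ≈⟨ +-cong eq refl ⟩
    b + c + c * (p ∸ 1)    ≈⟨ absorb b ⟩
    b                      ∎
    where
    open ≈-Reasoning
    absorb : ∀ d → d + c + c * (p ∸ 1) ≈ d
    absorb d = trans
      (cong (_% p) (trans (+-assoc d c _)
        (cong (d +_) (trans (sym (*-suc c (p ∸ 1))) (cong (c *_) (suc-pred p))))))
      ([m+kn]%n≡m%n d c p)

  coprime⇒inverse : ∀ {a} → Coprime p a → ∃[ b ] a * b ≈ 1
  coprime⇒inverse {a} coprime with coprime-Bézout (Coprimality.sym coprime)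
  ... | Bézout.+- x y eq = x ,
    trans (cong (_% p) (trans (*-comm a x) (sym eq))) ([m+kn]%n≡m%n 1 y p)
  -- From 1 + xa = yp we get (xa)² + 2yp = 1 + (yp)².
  ... | Bézout.-+ x y eq = x * x * a , +-cancelʳ (2 * (y * p)) (begin
    a * (x * x * a) + 2 * (y * p)          ≡⟨ cong (λ m → a * (x * x * a) + 2 * m) eq ⟨
    a * (x * x * a) + 2 * (1 + x * a)      ≡⟨ square a x ⟩
    1 + (1 + x * a) * (1 + x * a)          ≡⟨ cong (λ m → 1 + m * m) eq ⟩
    1 + y * p * (y * p)                    ≡⟨ cong (1 +_) (*-assoc (y * p) y p) ⟨
    1 + y * p * y * p                      ≈⟨ [m+kn]%n≡m%n 1 (y * p * y) p ⟩
    1                                      ≈⟨ [m+kn]%n≡m%n 1 (2 * y) p ⟨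
    1 + 2 * y * p                          ≡⟨ cong (1 +_) (*-assoc 2 y p) ⟩
    1 + 2 * (y * p)                        ∎)
    where
    open ≈-Reasoning
    square : ∀ a x → a * (x * x * a) + 2 * (1 + x * a) ≡ 1 + (1 + x * a) * (1 + x * a)
    square = solve-∀

  module _ {A : Set} where

    sum-constant : ∀ {c} (f : A → ℕ) → (∀ x → f x ≈ c) → ∀ xs → sum (map f xs) ≈ length xs * c
    sum-constant f f≈c []       = refl
    sum-constant f f≈c (x ∷ xs) = +-cong (f≈c x) (sum-constant f f≈c xs)

sum-map-+ : {A : Set} (f g : A → ℕ) → ∀ xs →
            sum (map (λ x → f x + g x) xs) ≡ sum (map f xs) + sum (map g xs)
sum-map-+ f g []       = refl
sum-map-+ f g (x ∷ xs) = trans (cong (f x + g x +_) (sum-map-+ f g xs))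
  (rearrange (f x) (g x) (sum (map f xs)) (sum (map g xs)))
  where
  rearrange : ∀ a b c d → a + b + (c + d) ≡ a + c + (b + d)
  rearrange = solve-∀

-- Markoff triples modulo p and the identities for their weights.

module Triples {p : ℕ} (prime : Prime p) where

  private instance
    p≢0 : NonZero p
    p≢0 = prime⇒nonZero prime

  open Congruence p

  Markoff : ℕ → ℕ → ℕ → Set
  Markoff x y z = x * x + y * y + z * z ≈ 3 * x * y * z

  Markoff-swap₁₂ : ∀ x y z → Markoff x y z → Markoff y x z
  Markoff-swap₁₂ x y z sol = begin
    y * y + x * x + z * z  ≡⟨ cong (_+ z * z) (+-comm (y * y) (x * x)) ⟩
    x * x + y * y + z * z  ≈⟨ sol ⟩
    3 * x * y * z          ≡⟨ product x y z ⟩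
    3 * y * x * z          ∎
    where
    open ≈-Reasoning
    product : ∀ x y z → 3 * x * y * z ≡ 3 * y * x * z
    product = solve-∀

  Markoff-swap₁₃ : ∀ x y z → Markoff x y z → Markoff z y x
  Markoff-swap₁₃ x y z sol = begin
    z * z + y * y + x * x  ≡⟨ squares x y z ⟩
    x * x + y * y + z * z  ≈⟨ sol ⟩
    3 * x * y * z          ≡⟨ product x y z ⟩
    3 * z * y * x          ∎
    where
    open ≈-Reasoning
    squares : ∀ x y z → z * z + y * y + x * x ≡ x * x + y * y + z * z
    squares = solve-∀
    product : ∀ x y z → 3 * x * y * z ≡ 3 * z * y * x
    product = solve-∀

  -- `x` and `x′` are the two roots of t² + y² + z² = 3yzt. After x² is added to both sides, the
  -- claim reduces to x′² + x(x′ + x) = x′(x′ + x) + x².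
  Markoff-vieta : ∀ x x′ y z → x′ + x ≈ 3 * y * z → Markoff x y z → Markoff x′ y z
  Markoff-vieta x x′ y z vieta sol = +-cancelʳ (x * x) (begin
    x′ * x′ + y * y + z * z + x * x    ≡⟨ eq₁ (x * x) (x′ * x′) (y * y) (z * z) ⟩
    x′ * x′ + (x * x + y * y + z * z)  ≈⟨ +-congˡ (x′ * x′) sol ⟩
    x′ * x′ + 3 * x * y * z            ≡⟨ cong (x′ * x′ +_) (eq₂ x y z) ⟩
    x′ * x′ + x * (3 * y * z)          ≈⟨ +-congˡ (x′ * x′) (*-congˡ x vieta) ⟨
    x′ * x′ + x * (x′ + x)             ≡⟨ eq₃ x x′ ⟩
    x′ * (x′ + x) + x * x              ≈⟨ +-cong (*-congˡ x′ vieta) refl ⟩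
    x′ * (3 * y * z) + x * x           ≡⟨ cong (_+ x * x) (eq₂ x′ y z) ⟨
    3 * x′ * y * z + x * x             ∎)
    where
    open ≈-Reasoning
    eq₁ : ∀ a b c d → b + c + d + a ≡ b + (a + c + d)
    eq₁ = solve-∀
    eq₂ : ∀ x y z → 3 * x * y * z ≡ x * (3 * y * z)
    eq₂ = solve-∀
    eq₃ : ∀ x x′ → x′ * x′ + x * (x′ + x) ≡ x′ * (x′ + x) + x * x
    eq₃ = solve-∀

  p∣square⇒p∣ : ∀ {a} → p ∣ a * a → p ∣ a
  p∣square⇒p∣ {a} p∣a² = [ id , id ] (euclidsLemma a a prime p∣a²)

  -- The equation collapses to z² ≈ 0. Hence a nonzero solution has at most one zero coordinate.
  Markoff-two-zeros : ∀ x y z → Markoff x y z → p ∣ x → p ∣ y → p ∣ z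
  Markoff-two-zeros x y z sol p∣x p∣y = p∣square⇒p∣ (≈0⇒∣ (begin
    z * z                  ≈⟨ +-cong (∣⇒≈0 (∣m∣n⇒∣m+n (∣m⇒∣m*n x p∣x) (∣m⇒∣m*n y p∣y))) refl ⟨
    x * x + y * y + z * z  ≈⟨ sol ⟩
    3 * x * y * z          ≈⟨ ∣⇒≈0 (∣m⇒∣m*n z (∣n⇒∣m*n (3 * x) p∣y)) ⟩
    0                      ∎))
    where open ≈-Reasoning

  inverse : ∀ a → p ∤ a → ∃[ b ] a * b ≈ 1
  inverse a p∤a = coprime⇒inverse λ (d∣p , d∣a) →
    [ id , (λ { refl → contradiction d∣a p∤a }) ] (prime⇒irreducible prime d∣p)

  -- For m = yz this is 2x/(yz). The value 3 at m = 0 keeps both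
  -- ratio-vieta and ratio-sum true for solutions with a zero coordinate.
  ratio : ℕ → ℕ → ℕ
  ratio x m with p ∣? m
  ... | yes _  = 3
  ... | no p∤m = 2 * x * proj₁ (inverse m p∤m)

  ratio-0 : ∀ x {m} → p ∣ m → ratio x m ≡ 3
  ratio-0 x {m} p∣m with p ∣? m
  ... | yes _  = refl
  ... | no p∤m = contradiction p∣m p∤m

  -- Exposes the inverse chosen by `ratio`, so that it can be reasoned about outside the case split
  -- on `p ∣? m`.
  ratio-inverse : ∀ m → p ∤ m → ∃[ i ] (m * i ≈ 1 × ∀ x → ratio x m ≡ 2 * x * i)
  ratio-inverse m p∤m with p ∣? m
  ... | yes p∣m = contradiction p∣m p∤m
  ... | no p∤m′ = proj₁ (inverse m p∤m′) , proj₂ (inverse m p∤m′) , λ _ → refl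

  ratio-vieta : ∀ x x′ y z → x′ + x ≈ 3 * y * z → ratio x (y * z) + ratio x′ (y * z) ≈ 6
  ratio-vieta x x′ y z vieta with p ∣? (y * z)
  -- Both ratios take the default value here, and 3 + 3 = 6.
  ... | yes _  = refl
  ... | no p∤m = begin
    2 * x * i + 2 * x′ * i  ≡⟨ eq₁ x x′ i ⟩
    2 * ((x′ + x) * i)      ≈⟨ *-congˡ 2 (*-cong vieta refl) ⟩
    2 * (3 * y * z * i)     ≡⟨ eq₂ y z i ⟩
    6 * (y * z * i)         ≈⟨ *-congˡ 6 (proj₂ (inverse (y * z) p∤m)) ⟩
    6                       ∎
    where
    open ≈-Reasoning
    i = proj₁ (inverse (y * z) p∤m)
    eq₁ : ∀ x x′ i → 2 * x * i + 2 * x′ * i ≡ 2 * ((x′ + x) * i)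
    eq₁ = solve-∀
    eq₂ : ∀ y z i → 2 * (3 * y * z * i) ≡ 6 * (y * z * i)
    eq₂ = solve-∀

  -- Writing i, j, k for the inverses of yz, xz, yx, multiply the Markoff
  -- equation by 2ijkxyz.
  ratio-sum-nonzero : ∀ x y z → Markoff x y z → p ∤ y * z → p ∤ x * z → p ∤ y * x →
                      ratio x (y * z) + ratio y (x * z) + ratio z (y * x) ≈ 6
  ratio-sum-nonzero x y z sol p∤yz p∤xz p∤yx
    with i , yzi≈1 , ratio-x ← ratio-inverse (y * z) p∤yz
       | j , xzj≈1 , ratio-y ← ratio-inverse (x * z) p∤xz
       | k , yxk≈1 , ratio-z ← ratio-inverse (y * x) p∤yx
    rewrite ratio-x x | ratio-y y | ratio-z z = begin
    2 * x * i + 2 * y * j + 2 * z * k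
      ≈⟨ +-cong (+-cong (absorb (2 * x * i) xzj≈1 yxk≈1) (absorb (2 * y * j) yzi≈1 yxk≈1))
                (absorb (2 * z * k) yzi≈1 xzj≈1) ⟨
    2 * x * i * (x * z * j * (y * x * k)) + 2 * y * j * (y * z * i * (y * x * k))
      + 2 * z * k * (y * z * i * (x * z * j))
      ≡⟨ eq₁ x y z i j k ⟩
    2 * (i * j * k * (x * y * z)) * (x * x + y * y + z * z)
      ≈⟨ *-congˡ (2 * (i * j * k * (x * y * z))) sol ⟩
    2 * (i * j * k * (x * y * z)) * (3 * x * y * z)
      ≡⟨ eq₂ x y z i j k ⟩
    6 * (y * z * i * (x * z * j * (y * x * k)))
      ≈⟨ *-congˡ 6 (*-cong yzi≈1 (*-cong xzj≈1 yxk≈1)) ⟩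
    6 ∎
    where
    open ≈-Reasoning
    absorb : ∀ a {b c} → b ≈ 1 → c ≈ 1 → a * (b * c) ≈ a
    absorb a b≈1 c≈1 = trans (*-congˡ a (*-cong b≈1 c≈1)) (cong (_% p) (*-identityʳ a))
    eq₁ : ∀ x y z i j k →
      2 * x * i * (x * z * j * (y * x * k)) + 2 * y * j * (y * z * i * (y * x * k))
        + 2 * z * k * (y * z * i * (x * z * j))
      ≡ 2 * (i * j * k * (x * y * z)) * (x * x + y * y + z * z)
    eq₁ = solve-∀
    eq₂ : ∀ x y z i j k → 2 * (i * j * k * (x * y * z)) * (3 * x * y * z)
      ≡ 6 * (y * z * i * (x * z * j * (y * x * k)))
    eq₂ = solve-∀

  ratio-zero-numerator : ∀ {x} m → p ∣ x → p ∤ m → ratio x m ≈ 0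
  ratio-zero-numerator {x} m p∣x p∤m with p ∣? m
  ... | yes p∣m = contradiction p∣m p∤m
  ... | no _    = ∣⇒≈0 (∣m⇒∣m*n _ (∣n⇒∣m*n 2 p∣x))

  ∤-* : ∀ {a b} → p ∤ a → p ∤ b → p ∤ a * b
  ∤-* {a} {b} p∤a p∤b p∣ab = [ p∤a , p∤b ] (euclidsLemma a b prime p∣ab)

  -- If a coordinate vanishes, the other two do not: its own ratio is 0 and the other two take the
  -- default value, so the sum is again 0 + 3 + 3. The factors are ordered as in the weights of the
  -- triples (x, y, z), (y, x, z) and (z, y, x).
  ratio-sum : ∀ x y z → Markoff x y z → ¬ (p ∣ x × p ∣ y × p ∣ z) →
              ratio x (y * z) + ratio y (x * z) + ratio z (y * x) ≈ 6
  ratio-sum x y z sol nonzero = by-cases (p ∣? x) (p ∣? y) (p ∣? z)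
    where
    x⇒¬y : p ∣ x → p ∤ y
    x⇒¬y p∣x p∣y = nonzero (p∣x , p∣y , Markoff-two-zeros x y z sol p∣x p∣y)
    y⇒¬z : p ∣ y → p ∤ z
    y⇒¬z p∣y p∣z = nonzero
      (Markoff-two-zeros z y x (Markoff-swap₁₃ x y z sol) p∣z p∣y , p∣y , p∣z)
    x⇒¬z : p ∣ x → p ∤ z
    x⇒¬z p∣x p∣z = nonzero (p∣x , Markoff-two-zeros z x y sol′ p∣z p∣x , p∣z)
      where
      sol′ : Markoff z x y
      sol′ = Markoff-swap₁₃ y x z (Markoff-swap₁₂ x y z sol)
    by-cases : Dec (p ∣ x) → Dec (p ∣ y) → Dec (p ∣ z) →
               ratio x (y * z) + ratio y (x * z) + ratio z (y * x) ≈ 6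
    by-cases (no p∤x) (no p∤y) (no p∤z) =
      ratio-sum-nonzero x y z sol (∤-* p∤y p∤z) (∤-* p∤x p∤z) (∤-* p∤y p∤x)
    by-cases (yes p∣x) _ _
      rewrite ratio-0 y (∣m⇒∣m*n z p∣x) | ratio-0 z (∣n⇒∣m*n y p∣x) =
      +-cong (+-cong (ratio-zero-numerator (y * z) p∣x (∤-* (x⇒¬y p∣x) (x⇒¬z p∣x))) refl) refl
    by-cases (no p∤x) (yes p∣y) _
      rewrite ratio-0 x (∣m⇒∣m*n z p∣y) | ratio-0 z (∣m⇒∣m*n x p∣y) =
      +-cong (+-congˡ 3 (ratio-zero-numerator (x * z) p∣y (∤-* p∤x (y⇒¬z p∣y)))) refl
    by-cases (no p∤x) (no p∤y) (yes p∣z)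
      rewrite ratio-0 x (∣n⇒∣m*n y p∣z) | ratio-0 y (∣n⇒∣m*n x p∣z) =
      +-congˡ 6 (ratio-zero-numerator (y * x) p∣z (∤-* p∤y p∤x))

-- Transfer from `Fin p` to congruences, and finiteness and decidability of the graph.

module MarkoffGraph {p : ℕ} (prime : Prime p) where

  private instance
    p≢0 : NonZero p
    p≢0 = prime⇒nonZero prime

  open Congruence p
  open Triples prime
  open module M = Markoff prime hiding (_+_; _*_; _-_)

  toℕ-fromℕ : ∀ n → toℕ (M.fromℕ n) ≈ n
  toℕ-fromℕ n = trans (cong (_% p) (Fin.toℕ-fromℕ< _)) (m%n%n≡m%n n p)

  toℕ-* : ∀ {x y m n} → toℕ x ≈ m → toℕ y ≈ n → toℕ (x M.* y) ≈ m * n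
  toℕ-* {x} {y} x≈m y≈n = trans (toℕ-fromℕ (toℕ x * toℕ y)) (*-cong x≈m y≈n)

  toℕ-+ : ∀ {x y m n} → toℕ x ≈ m → toℕ y ≈ n → toℕ (x M.+ y) ≈ m + n
  toℕ-+ {x} {y} x≈m y≈n = trans (toℕ-fromℕ (toℕ x + toℕ y)) (+-cong x≈m y≈n)

  toℕ-‿- : ∀ x y → toℕ (x M.- y) + toℕ y ≈ toℕ x
  toℕ-‿- x y = begin
    toℕ (x M.- y) + toℕ y            ≈⟨ +-cong (toℕ-fromℕ (toℕ x + (p ∸ toℕ y))) refl ⟩
    toℕ x + (p ∸ toℕ y) + toℕ y      ≡⟨ +-assoc (toℕ x) _ _ ⟩
    toℕ x + (p ∸ toℕ y + toℕ y)      ≡⟨ cong (toℕ x +_) (m∸n+n≡m (Fin.toℕ≤n y)) ⟩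
    toℕ x + p                        ≈⟨ [m+n]%n≡m%n (toℕ x) p ⟩
    toℕ x                            ∎
    where open ≈-Reasoning

  toℕ-injective-≈ : ∀ {x y : 𝔽} → toℕ x ≈ toℕ y → x ≡ y
  toℕ-injective-≈ {x} {y} eq = Fin.toℕ-injective
    (trans (sym (m<n⇒m%n≡m (Fin.toℕ<n x))) (trans eq (m<n⇒m%n≡m (Fin.toℕ<n y))))

  module _ {x y z : 𝔽} where

    private
      lhs : toℕ (x M.* x M.+ y M.* y M.+ z M.* z) ≈
            toℕ x * toℕ x + toℕ y * toℕ y + toℕ z * toℕ z
      lhs = toℕ-+ (toℕ-+ (toℕ-* {x} {x} refl refl) (toℕ-* {y} {y} refl refl)) (toℕ-* {z} {z} refl refl)

      rhs : toℕ (M.fromℕ 3 M.* x M.* y M.* z) ≈ 3 * toℕ x * toℕ y * toℕ z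
      rhs = toℕ-* {y = z} (toℕ-* {y = y} (toℕ-* {y = x} (toℕ-fromℕ 3) refl) refl) refl

    IsSolution⇒Markoff : IsSolution (x ∷ y ∷ z ∷ []) → Markoff (toℕ x) (toℕ y) (toℕ z)
    IsSolution⇒Markoff sol = trans (sym lhs) (trans (cong (λ w → toℕ w % p) sol) rhs)

    Markoff⇒IsSolution : Markoff (toℕ x) (toℕ y) (toℕ z) → IsSolution (x ∷ y ∷ z ∷ [])
    Markoff⇒IsSolution sol = toℕ-injective-≈ (trans lhs (trans sol (sym rhs)))

  vieta : 𝔽 → 𝔽 → 𝔽 → 𝔽
  vieta x y z = M.fromℕ 3 M.* y M.* z M.- x

  vieta-sum : ∀ x y z → toℕ (vieta x y z) + toℕ x ≈ 3 * toℕ y * toℕ z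
  vieta-sum x y z = trans (toℕ-‿- (M.fromℕ 3 M.* y M.* z) x)
    (toℕ-* {y = z} (toℕ-* {y = y} (toℕ-fromℕ 3) refl) refl)

  vieta-involutive : ∀ x y z → vieta (vieta x y z) y z ≡ x
  vieta-involutive x y z = toℕ-injective-≈ (+-cancelʳ (toℕ (vieta x y z))
    (trans (vieta-sum (vieta x y z) y z)
      (trans (sym (vieta-sum x y z)) (cong (_% p) (+-comm (toℕ (vieta x y z)) (toℕ x))))))

  -- The zero triple is fixed by ℛ₁, so the involution ℛ₁ sends no nonzero triple to it.
  vieta-0 : vieta (M.fromℕ 0) (M.fromℕ 0) (M.fromℕ 0) ≡ M.fromℕ 0
  vieta-0 = toℕ-injective-≈ (+-cancelʳ (toℕ O)
    (trans (vieta-sum O O O) (trans (*-cong (*-congˡ 3 O≈0) O≈0) (sym (+-cong O≈0 O≈0)))))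
    where
    O = M.fromℕ 0
    O≈0 : toℕ O ≈ 0
    O≈0 = toℕ-fromℕ 0

  solution? : ∀ v → Dec (IsSolution v)
  solution? (x ∷ y ∷ z ∷ []) = _ Fin.≟ _

  _≟³_ : DecidableEquality 𝔽³
  _≟³_ = Vec.≡-dec Fin._≟_

  vertex-≡ : ∀ {v w : Vertex} → coords v ≡ coords w → v ≡ w
  vertex-≡ {vertex _ _ _} {vertex _ _ _} refl = refl

  _≟ᵛ_ : DecidableEquality Vertex
  v ≟ᵛ w = map′ vertex-≡ (cong coords) (coords v ≟³ coords w)

  verticesAt : 𝔽³ → List Vertex
  verticesAt v with ¬? (v ≟³ replicate 3 (M.fromℕ 0)) | solution? v
  ... | yes nonzero | yes solution = vertex v nonzero solution ∷ []
  ... | _           | _            = []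

  ∈-verticesAt : ∀ v → v ∈ verticesAt (coords v)
  ∈-verticesAt (vertex v nonzero solution)
    with ¬? (v ≟³ replicate 3 (M.fromℕ 0)) | solution? v
  ... | yes _ | yes _ = here refl
  -- The proofs stored in a vertex are irrelevant; `recompute` recovers usable ones from the
  -- decision procedures.
  ... | no ¬n | _     = contradiction (recompute (¬? (v ≟³ replicate 3 (M.fromℕ 0))) nonzero) ¬n
  ... | yes _ | no ¬s = contradiction (recompute (solution? v) solution) ¬s

  vertices : List Vertex
  vertices = concatMap verticesAt (vectors (allFin p) 3)

  vertices-complete : ∀ v → v ∈ vertices
  vertices-complete v =
    ∈-concatMap⁺ verticesAt (lose (vectors-complete ∈-allFin (coords v)) (∈-verticesAt v))

  permute-cong : ∀ {π ρ : Permutation′ 3} → (∀ i → π ⟨$⟩ʳ i ≡ ρ ⟨$⟩ʳ i) →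
                 ∀ v → ⟦ permute π ⟧ v ≡ ⟦ permute ρ ⟧ v
  permute-cong eq v = Vec.tabulate-cong (λ i → cong (lookup v) (eq i))

  transformations : List Transformation
  transformations = ℛ₁ ∷ ℛ₂ ∷ ℛ₃ ∷ map permute (permutations 3)

  -- `⟦ permute π ⟧` depends only on the values of `π`, so it suffices to test one representative of
  -- each permutation.
  Edge? : Decidable Edge
  Edge? v w = map′ satisfied complete
    (any? (λ T → coords w ≟³ ⟦ T ⟧ (coords v)) transformations)
    where
    complete : Edge v w → Any (λ T → coords w ≡ ⟦ T ⟧ (coords v)) transformations
    complete (ℛ₁ , eq) = here eq
    complete (ℛ₂ , eq) = there (here eq)
    complete (ℛ₃ , eq) = there (there (here eq))
    complete (permute π , eq) =
      let ρ , ρ∈ , ρ≈π = permutations-complete π in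
      there (there (there (lose (∈-map⁺ permute ρ∈)
        (trans eq (permute-cong {π} {ρ} (λ i → sym (ρ≈π i)) (coords v))))))

  component-size : ∀ v → ∃[ N ] HasSize (Component v) N
  component-size v = hasSize _≟ᵛ_ vertices vertices-complete
    (Reachability.Star? _ _≟ᵛ_ (SymClosure? Edge?) vertices vertices-complete v)

  -- Three involutions along edges, and the weight.

  reflect swap₁₂ swap₁₃ : Vertex → Vertex

  reflect (vertex (x ∷ y ∷ z ∷ []) nonzero solution) = vertex (vieta x y z ∷ y ∷ z ∷ [])
    -- If the image were zero, reflecting it once more would give both the original triple and zero.
    (λ eq → nonzero (trans (cong (_∷ y ∷ z ∷ []) (sym (vieta-involutive x y z))) (image-0 eq)))
    (Markoff⇒IsSolution (Markoff-vieta (toℕ x) (toℕ (vieta x y z)) (toℕ y) (toℕ z)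
      (vieta-sum x y z) (IsSolution⇒Markoff solution)))
    where
    image-0 : ∀ {x} → x ∷ y ∷ z ∷ [] ≡ replicate 3 (M.fromℕ 0) →
              vieta x y z ∷ y ∷ z ∷ [] ≡ replicate 3 (M.fromℕ 0)
    image-0 refl = cong (_∷ M.fromℕ 0 ∷ M.fromℕ 0 ∷ []) vieta-0

  swap₁₂ (vertex (x ∷ y ∷ z ∷ []) nonzero solution) = vertex (y ∷ x ∷ z ∷ [])
    (λ { refl → nonzero refl })
    (Markoff⇒IsSolution (Markoff-swap₁₂ (toℕ x) (toℕ y) (toℕ z) (IsSolution⇒Markoff solution)))

  swap₁₃ (vertex (x ∷ y ∷ z ∷ []) nonzero solution) = vertex (z ∷ y ∷ x ∷ [])
    (λ { refl → nonzero refl })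
    (Markoff⇒IsSolution (Markoff-swap₁₃ (toℕ x) (toℕ y) (toℕ z) (IsSolution⇒Markoff solution)))

  reflect-involutive : ∀ v → reflect (reflect v) ≡ v
  reflect-involutive (vertex (x ∷ y ∷ z ∷ []) _ _) =
    vertex-≡ (cong (_∷ y ∷ z ∷ []) (vieta-involutive x y z))

  swap₁₂-involutive : ∀ v → swap₁₂ (swap₁₂ v) ≡ v
  swap₁₂-involutive (vertex (x ∷ y ∷ z ∷ []) _ _) = refl

  swap₁₃-involutive : ∀ v → swap₁₃ (swap₁₃ v) ≡ v
  swap₁₃-involutive (vertex (x ∷ y ∷ z ∷ []) _ _) = refl

  reflect-edge : ∀ v → Edge v (reflect v)
  reflect-edge (vertex (x ∷ y ∷ z ∷ []) _ _) = ℛ₁ , refl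

  swap₁₂-edge : ∀ v → Edge v (swap₁₂ v)
  swap₁₂-edge (vertex (x ∷ y ∷ z ∷ []) _ _) = permute (transpose fzero (fsuc fzero)) , refl

  swap₁₃-edge : ∀ v → Edge v (swap₁₃ v)
  swap₁₃-edge (vertex (x ∷ y ∷ z ∷ []) _ _) = permute (transpose fzero (fsuc (fsuc fzero))) , refl

  weight : Vertex → ℕ
  weight (vertex (x ∷ y ∷ z ∷ []) _ _) = ratio (toℕ x) (toℕ y * toℕ z)

  weight-reflect : ∀ v → weight v + weight (reflect v) ≈ 6
  weight-reflect (vertex (x ∷ y ∷ z ∷ []) _ _) =
    ratio-vieta (toℕ x) (toℕ (vieta x y z)) (toℕ y) (toℕ z) (vieta-sum x y z)

  weight-swaps : ∀ v → weight v + weight (swap₁₂ v) + weight (swap₁₃ v) ≈ 6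
  weight-swaps (vertex v@(x ∷ y ∷ z ∷ []) nonzero solution) =
    ratio-sum (toℕ x) (toℕ y) (toℕ z) (IsSolution⇒Markoff (recompute (solution? v) solution))
      λ (p∣x , p∣y , p∣z) → recompute (¬? (v ≟³ replicate 3 (M.fromℕ 0))) nonzero
        (cong₂ _∷_ (≡0 p∣x) (cong₂ _∷_ (≡0 p∣y) (cong (_∷ []) (≡0 p∣z))))
    where
    ≡0 : ∀ {x} → p ∣ toℕ x → x ≡ M.fromℕ 0
    ≡0 p∣x = toℕ-injective-≈ (trans (∣⇒≈0 p∣x) (sym (toℕ-fromℕ 0)))

  -- The total weight of a component and the resulting bound on its size.

  module _ {v : Vertex} {N : ℕ} (size : HasSize (Component v) N) where

    private
      ws = proj₁ size
      unique = proj₁ (proj₂ size)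
      ws⇔Component = proj₁ (proj₂ (proj₂ size))
      length≡N = proj₂ (proj₂ (proj₂ size))

    -- The edge from `w` to `φ w` keeps `φ w` in the component, so the involution `φ` permutes `ws`.
    sum-invariant : (φ : Vertex → Vertex) → (∀ w → φ (φ w) ≡ w) → (∀ w → Edge w (φ w)) →
                    sum (map (weight ∘ φ) ws) ≡ sum (map weight ws)
    sum-invariant φ involutive edge = trans (cong sum (map-∘ ws))
      (sum-↭ (↭-map⁺ weight (map-involution-↭ φ involutive unique closed)))
      where
      closed : ∀ {w} → w ∈ ws → φ w ∈ ws
      closed {w} w∈ = Equivalence.from (ws⇔Component (φ w))
        (Equivalence.to (ws⇔Component w) w∈ ◅◅ fwd (edge w) ◅ ε)

    -- Computing 6S as 2(3S) and as 3(2S) gives 12N ≈ 18N. Nothing is divided by 2 or 3, so these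
    -- primes need no separate treatment.
    p∣6*size : p ∣ 6 * N
    p∣6*size = ≈0⇒∣ (sym (+-cancelʳ (12 * N) (begin
      12 * N              ≡⟨ eq₁ N ⟩
      2 * (N * 6)         ≈⟨ *-congˡ 2 3S≈6N ⟨
      2 * (S + S + S)     ≡⟨ eq₂ S ⟩
      3 * (S + S)         ≈⟨ *-congˡ 3 2S≈6N ⟩
      3 * (N * 6)         ≡⟨ eq₃ N ⟩
      6 * N + 12 * N      ∎)))
      where
      open ≈-Reasoning
      S = sum (map weight ws)
      2S≈6N : S + S ≈ N * 6
      2S≈6N = begin
        S + S
          ≡⟨ cong (λ n → S + n) (sum-invariant reflect reflect-involutive reflect-edge) ⟨
        S + sum (map (weight ∘ reflect) ws)
          ≡⟨ sum-map-+ weight (weight ∘ reflect) ws ⟨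
        sum (map (λ w → weight w + weight (reflect w)) ws)
          ≈⟨ sum-constant _ weight-reflect ws ⟩
        length ws * 6
          ≡⟨ cong (_* 6) length≡N ⟩
        N * 6 ∎
      3S≈6N : S + S + S ≈ N * 6
      3S≈6N = begin
        S + S + S
          ≡⟨ cong₂ (λ m n → S + m + n)
               (sum-invariant swap₁₂ swap₁₂-involutive swap₁₂-edge)
               (sum-invariant swap₁₃ swap₁₃-involutive swap₁₃-edge) ⟨
        S + sum (map (weight ∘ swap₁₂) ws) + sum (map (weight ∘ swap₁₃) ws)
          ≡⟨ cong (_+ sum (map (weight ∘ swap₁₃) ws)) (sum-map-+ weight (weight ∘ swap₁₂) ws) ⟨
        sum (map (λ w → weight w + weight (swap₁₂ w)) ws) + sum (map (weight ∘ swap₁₃) ws)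
          ≡⟨ sum-map-+ (λ w → weight w + weight (swap₁₂ w)) (weight ∘ swap₁₃) ws ⟨
        sum (map (λ w → weight w + weight (swap₁₂ w) + weight (swap₁₃ w)) ws)
          ≈⟨ sum-constant _ weight-swaps ws ⟩
        length ws * 6
          ≡⟨ cong (_* 6) length≡N ⟩
        N * 6 ∎
      eq₁ : ∀ n → 12 * n ≡ 2 * (n * 6)
      eq₁ = solve-∀
      eq₂ : ∀ s → 2 * (s + s + s) ≡ 3 * (s + s)
      eq₂ = solve-∀
      eq₃ : ∀ n → 3 * (n * 6) ≡ 6 * n + 12 * n
      eq₃ = solve-∀

    -- The empty path puts `v` in its own component. Positivity is what turns p ∣ 6N into p ≤ 6N.
    size-positive : 1 ℕ.≤ N
    size-positive with ws | ws⇔Component | length≡N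
    ... | []    | ⇔ | _    = contradiction (Equivalence.from (⇔ v) ε) λ ()
    ... | _ ∷ _ | _ | refl = ℕ.s≤s ℕ.z≤n

    p≤6*size : p ℕ.≤ 6 * N
    p≤6*size = ∣⇒≤ {{m*n≢0 6 N {{_}} {{ℕ.>-nonZero size-positive}}}} p∣6*size

theorem1p3 : ∃[ c ] (0ℚ < c ×
    (∀ {p : ℕ} (prime : Prime p) (v : Markoff.Vertex prime) →
    ∃[ N ] (HasSize (Markoff.Component prime v) N ×
    c · log p ^[ 7 / 9 ] ≤ℝ fromℕ N)))
theorem1p3 = c , ℚ.positive⁻¹ c , λ {p} prime v →
  let open MarkoffGraph prime
      N , size = component-size v
  in N , size , λ { (r , r∈ , refl) →
       bound {p} {N} (ℕ.>-nonZero⁻¹ p {{prime⇒nonZero prime}}) (p≤6*size size) r∈ }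
  where
  -- Chosen to cancel the 6 in p ≤ 6N.
  c = ℤ.+ 1 ℚ./ 6
  bound : ∀ {p N r} → 1 ℕ.≤ p → p ℕ.≤ 6 * N → (log p ^[ 7 / 9 ]) r → c ℚ.* r ℚ.≤ fromℕ N
  bound {p} {N} {r} 1≤p p≤6N r∈ = begin
    -- The exponent matters only through 7 ≤ 7 + 2 = 9.
    c ℚ.* r                        ≤⟨ ℚ.*-monoˡ-≤-nonNeg c (log-power-≤ {p} 1≤p (m≤m+n 7 2) r∈) ⟩
    c ℚ.* fromℕ p                  ≤⟨ ℚ.*-monoˡ-≤-nonNeg c (fromℕ-mono-≤ p≤6N) ⟩
    c ℚ.* fromℕ (6 * N)            ≡⟨ cong (c ℚ.*_) (fromℕ-* 6 N) ⟩
    c ℚ.* (fromℕ 6 ℚ.* fromℕ N)    ≡⟨ ℚ.*-assoc c (fromℕ 6) (fromℕ N) ⟨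
    -- The closed product `c ℚ.* fromℕ 6` evaluates to `1ℚ`.
    c ℚ.* fromℕ 6 ℚ.* fromℕ N      ≡⟨ ℚ.*-identityˡ (fromℕ N) ⟩
    fromℕ N                        ∎
    where open ℚ.≤-Reasoning
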